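{- Let $n\in\mathbb N$ be divisible by $3$. Suppose $G$ is an $n$-vertex digraph such that for all distinct $x,y\in V(G)$ with $xy\notin E(G)$ we have $d^+_G(x)+d^-_G(y)\ge 4n/3-1$. Then $G$ contains a $T_3$-factor.
   Context: Digraphs have no loops and at most one edge in each direction between any pair of vertices; $xy$ denotes the edge from $x$ to $y$. $d^+_G(x)$ and $d^-_G(x)$ are the out-degree and in-degree of $x$. $T_r$ denotes the transitive tournament on $r$ vertices. A $T_3$-factor is a collection of vertex-disjoint copies of $T_3$ in $G$ covering all vertices. -}

module Defs where

open import Data.Nat using (ℕ)
open import Data.Bool using (Bool; true; false)
open import Data.Fin using (Fin; zero; suc)
open import Data.List using (List; length; filterᵇ)
open import Data.List using () renaming (allFin to allFinL)
open import Data.Product using (Σ; _×_; _,_; ∃-syntax)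
open import Relation.Binary.PropositionalEquality using (_≡_)
open import Function.Definitions using (Injective; Surjective)

record Digraph (n : ℕ) : Set where
  field
    adj     : Fin n → Fin n → Bool
    noLoops : ∀ x → adj x x ≡ false

open Digraph public

Edge : ∀ {n} → Digraph n → Fin n → Fin n → Set
Edge G x y = adj G x y ≡ true

outdeg : ∀ {n} → Digraph n → Fin n → ℕ
outdeg {n} G x = length (filterᵇ (λ y → adj G x y) (allFinL n))

indeg : ∀ {n} → Digraph n → Fin n → ℕ
indeg {n} G y = length (filterᵇ (λ x → adj G x y) (allFinL n))

IsT3 : ∀ {n} → Digraph n → Fin n → Fin n → Fin n → Set
IsT3 G a b c = Edge G a b × Edge G b c × Edge G a c

-- A T₃-factor: k triples t i = (t i 0, t i 1, t i 2), each spanning a copy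
-- of T₃, such that the map (i , j) ↦ t i j is a bijection Fin k × Fin 3 → Fin n
-- (vertex-disjoint, each triple has 3 distinct vertices, covering all vertices).
HasT3Factor : ∀ {n} → Digraph n → Set
HasT3Factor {n} G =
  ∃[ k ] Σ (Fin k → Fin 3 → Fin n) λ t →
      (∀ i → IsT3 G (t i zero) (t i (suc zero)) (t i (suc (suc zero))))
    × Injective _≡_ _≡_ (λ (p : Σ (Fin k) (λ _ → Fin 3)) → t (Data.Product.proj₁ p) (Data.Product.proj₂ p))
    × Surjective _≡_ _≡_ (λ (p : Σ (Fin k) (λ _ → Fin 3)) → t (Data.Product.proj₁ p) (Data.Product.proj₂ p))

{-# OPTIONS --safe #-}
module Submission where

-- Adding edges one at a time, it suffices to recover a T₃-factor of G from one of G + xy, that is,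
-- from a cover of the vertices by vertex-disjoint T₃'s (tiles) and one triple a, b, c in which b is
-- adjacent to a and c. Let w(x, y) ∈ {0, 1, 2} be the number of edges between x and y, and let n = 3k.
-- A triangle which is not a cyclic one with three single edges contains T₃.
--
-- If the uncovered triple is a cyclic triangle, its three nonedges form a directed cycle, so the
-- degree sum of its vertices is at least 12k - 3 and it sends at least 13 edges to some tile. An
-- exchange then yields two T₃'s. So it suffices to leave any triangle uncovered.
--
-- If a and c are nonadjacent, then d(a) + d(c) ≥ 8k - 2, so a and c together send at least 9 edges
-- to some tile, say a at least 5 and c at least 3. Then c can replace a vertex t of the tile; let
-- p, q be the other two. Now a, b, t is uncovered and we may assume that b and t are nonadjacent, so
-- also d(b) + d(t) ≥ 8k - 2. As each of a, c, t forms a T₃ with p, q, there are several ways to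
-- regroup the six vertices a, b, c, t, p, q with a further tile. The function
-- 2 (w(b, v) + w(t, v)) + w(a, v) + w(c, v) has sum at least 24k - 6 over all v, and at most 40
-- over the six vertices, so its sum over one of the other k - 2 tiles exceeds 24; a check over all
-- possible weights then finds a suitable regrouping.

open import Defs
open import Data.Bool using (Bool; true; false; T; not; _∧_; _∨_; if_then_else_)
open import Data.Bool.Properties using (T-∧; T-∨; T-≡)
open import Data.Fin using (Fin; zero; suc)
open import Data.Fin.Properties using () renaming (_≟_ to _≟ᶠ_)
open import Data.List using (List; []; _∷_; _++_; length; map; filterᵇ; allFin; foldr; lookup; cartesianProduct)
open import Data.List.Membership.Propositional using (_∈_)
open import Data.List.Membership.Propositional.Properties using (∈-allFin; ∈-lookup; ∈-cartesianProduct⁺)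
open import Data.List.Properties using (length-tabulate; map-++; length-++)
open import Data.List.Relation.Binary.Permutation.Propositional
  using (_↭_; prep; swap; ↭-refl; ↭-sym; ↭-trans; ↭-reflexive; ↭⇒↭ₛ) renaming (refl to ↭refl; trans to ↭tr)
open import Data.List.Relation.Binary.Permutation.Propositional.Properties
  using (All-resp-↭; ∈-resp-↭; ↭-length; map⁺; ++⁺ˡ; ++⁺ʳ; shifts)
open import Data.List.Relation.Binary.Permutation.Setoid.Properties using (Unique-resp-↭)
open import Data.List.Relation.Unary.All using (All; []; _∷_) renaming (lookup to lookupᴬ)
open import Data.List.Relation.Unary.AllPairs using ([]; _∷_)
open import Data.List.Relation.Unary.Any using (here; there)
open import Data.List.Relation.Unary.Unique.Propositional using (Unique)
open import Data.List.Relation.Unary.Unique.Propositional.Properties using (allFin⁺)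
open import Data.Nat using (ℕ; zero; suc; _+_; _*_; _≤_; _<_; _≥_; _≤ᵇ_; z≤n; s≤s; s≤s⁻¹; _≤?_; _<?_)
open import Data.Nat.Divisibility using (_∣_; divides)
open import Data.Nat.ListAction using (sum)
open import Data.Nat.ListAction.Properties using (sum-++; sum-↭)
open import Data.Nat.Properties
open import Data.Nat.Tactic.RingSolver using (solve-∀)
open import Data.Product using (Σ; _×_; _,_; proj₁; proj₂; ∃-syntax)
open import Data.Sum using (_⊎_; inj₁; inj₂; [_,_]′)
open import Function using (_∘_)
open import Function.Bundles using (Equivalence)
open import Relation.Binary.PropositionalEquality
  using (_≡_; _≢_; refl; sym; trans; cong; cong₂; subst) renaming (setoid to ≡-setoid)
open import Relation.Nullary using (¬_; contradiction; Dec; yes; no)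
open import Relation.Nullary.Decidable using (⌊_⌋)

-- Permutations of lists, triples and sums.

module _ {A : Set} where

  underHead : (List A → List A) → List A → List A
  underHead f []       = []
  underHead f (x ∷ xs) = x ∷ f xs

  insertSecond : A → List A → List A
  insertSecond x []       = x ∷ []
  insertSecond x (y ∷ ys) = y ∷ x ∷ ys

  bringToFront : ℕ → List A → List A
  bringToFront zero    xs       = xs
  bringToFront (suc i) []       = []
  bringToFront (suc i) (x ∷ xs) = insertSecond x (bringToFront i xs)

  -- select (i₁ ∷ i₂ ∷ …) xs starts with entry i₁ of xs, then entry i₂ of what remains, and so on.
  select : List ℕ → List A → List A
  select []       xs = xs
  select (i ∷ is) xs = underHead (select is) (bringToFront i xs)

  underHead-↭ : ∀ {f} → (∀ xs → xs ↭ f xs) → ∀ xs → xs ↭ underHead f xs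
  underHead-↭ p []       = ↭-refl
  underHead-↭ p (x ∷ xs) = prep x (p xs)

  insertSecond-↭ : ∀ x xs → x ∷ xs ↭ insertSecond x xs
  insertSecond-↭ x []       = ↭-refl
  insertSecond-↭ x (y ∷ ys) = swap x y ↭-refl

  bringToFront-↭ : ∀ i xs → xs ↭ bringToFront i xs
  bringToFront-↭ zero    xs       = ↭-refl
  bringToFront-↭ (suc i) []       = ↭-refl
  bringToFront-↭ (suc i) (x ∷ xs) = ↭-trans (prep x (bringToFront-↭ i xs)) (insertSecond-↭ x _)

  select-↭ : ∀ is xs → xs ↭ select is xs
  select-↭ []       xs = ↭-refl
  select-↭ (i ∷ is) xs = ↭-trans (bringToFront-↭ i xs) (underHead-↭ (select-↭ is) (bringToFront i xs))

  flat : List (A × A × A) → List A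
  flat []                 = []
  flat ((x , y , z) ∷ ts) = x ∷ y ∷ z ∷ flat ts

  flat-↭ : ∀ {ts us} → ts ↭ us → flat ts ↭ flat us
  flat-↭ ↭refl = ↭-refl
  flat-↭ (prep (x , y , z) p) = prep x (prep y (prep z (flat-↭ p)))
  flat-↭ (swap (x , y , z) (x′ , y′ , z′) p) =
    ↭-trans (shifts (x ∷ y ∷ z ∷ []) (x′ ∷ y′ ∷ z′ ∷ []))
            (++⁺ˡ (x′ ∷ y′ ∷ z′ ∷ x ∷ y ∷ z ∷ []) (flat-↭ p))
  flat-↭ (↭tr p q) = ↭-trans (flat-↭ p) (flat-↭ q)

  length-flat : ∀ ts → length (flat ts) ≡ 3 * length ts
  length-flat []       = refl
  length-flat (_ ∷ ts) = trans (cong (3 +_) (length-flat ts)) (sym (*-suc 3 (length ts)))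

  ∑ : (A → ℕ) → List A → ℕ
  ∑ f xs = sum (map f xs)

  ∑-↭ : ∀ (f : A → ℕ) {xs ys} → xs ↭ ys → ∑ f xs ≡ ∑ f ys
  ∑-↭ f p = sum-↭ (map⁺ f p)

  ∑-++ : ∀ (f : A → ℕ) xs ys → ∑ f (xs ++ ys) ≡ ∑ f xs + ∑ f ys
  ∑-++ f xs ys = trans (cong sum (map-++ f xs ys)) (sum-++ (map f xs) (map f ys))

  ∑-+ : ∀ (f g : A → ℕ) xs → ∑ (λ x → f x + g x) xs ≡ ∑ f xs + ∑ g xs
  ∑-+ f g []       = refl
  ∑-+ f g (x ∷ xs) rewrite ∑-+ f g xs = lemma (f x) (g x) (∑ f xs) (∑ g xs)
    where
    lemma : ∀ a b c d → a + b + (c + d) ≡ a + c + (b + d)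
    lemma = solve-∀

  ∑-+₃ : ∀ (f g h : A → ℕ) xs → ∑ (λ x → f x + (g x + h x)) xs ≡ ∑ f xs + (∑ g xs + ∑ h xs)
  ∑-+₃ f g h xs = trans (∑-+ f (λ x → g x + h x) xs) (cong (∑ f xs +_) (∑-+ g h xs))

  ∑-* : ∀ c (f : A → ℕ) xs → ∑ (λ x → c * f x) xs ≡ c * ∑ f xs
  ∑-* c f []       = sym (*-zeroʳ c)
  ∑-* c f (x ∷ xs) rewrite ∑-* c f xs = sym (*-distribˡ-+ c (f x) (∑ f xs))

  ∑-gadget : ∀ (f g h k : A → ℕ) xs →
    ∑ (λ x → 2 * (f x + g x) + (h x + k x)) xs ≡ 2 * (∑ f xs + ∑ g xs) + (∑ h xs + ∑ k xs)
  ∑-gadget f g h k xs = trans (∑-+ (λ x → 2 * (f x + g x)) (λ x → h x + k x) xs)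
    (cong₂ _+_ (trans (∑-* 2 (λ x → f x + g x) xs) (cong (2 *_) (∑-+ f g xs))) (∑-+ h k xs))

  -- The heavy triple is moved to the front so that it can be split off from a cover.
  ∑-flat-pigeonhole : ∀ (f : A → ℕ) c ts →
    ∑ f (flat ts) ≤ c * length ts ⊎
    ∃[ x ] ∃[ y ] ∃[ z ] ∃[ us ] ts ↭ (x , y , z) ∷ us × c < ∑ f (x ∷ y ∷ z ∷ [])
  ∑-flat-pigeonhole f c [] = inj₁ z≤n
  ∑-flat-pigeonhole f c (t@(x , y , z) ∷ ts) with c <? ∑ f (x ∷ y ∷ z ∷ [])
  ... | yes c<t = inj₂ (x , y , z , ts , ↭-refl , c<t)
  ... | no  c≮t with ∑-flat-pigeonhole f c ts
  ...   | inj₂ (x′ , y′ , z′ , us , p , c<t′) =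
            inj₂ (x′ , y′ , z′ , t ∷ us , ↭-trans (prep t p) (swap t _ ↭-refl) , c<t′)
  ...   | inj₁ ts≤ = inj₁ (begin
            ∑ f (flat (t ∷ ts))                    ≡⟨ ∑-++ f (x ∷ y ∷ z ∷ []) (flat ts) ⟩
            ∑ f (x ∷ y ∷ z ∷ []) + ∑ f (flat ts)   ≤⟨ +-mono-≤ (≮⇒≥ c≮t) ts≤ ⟩
            c + c * length ts                      ≡⟨ *-suc c (length ts) ⟨
            c * suc (length ts)                    ∎)
            where open ≤-Reasoning

-- Weight vectors and the finite exchange checks.

W : Set
W = ℕ × ℕ × ℕ

-- An element of `W` holds the weights from one vertex to the three vertices of a tile. The trailing
-- 0 makes `size` definitionally equal to a `∑` over that tile.
size : W → ℕ
size (x₁ , x₂ , x₃) = x₁ + (x₂ + (x₃ + 0))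

Small : W → Set
Small (x₁ , x₂ , x₃) = x₁ ≤ 2 × x₂ ≤ 2 × x₃ ≤ 2

upTo2 : (ℕ → Bool) → Bool
upTo2 p = p 0 ∧ p 1 ∧ p 2

allSmall : (W → Bool) → Bool
allSmall p = upTo2 λ x₁ → upTo2 λ x₂ → upTo2 λ x₃ → p (x₁ , x₂ , x₃)

upTo2-sound : ∀ p → upTo2 p ≡ true → ∀ {x} → x ≤ 2 → p x ≡ true
upTo2-sound p ok x≤2 with p 0 in p0 | p 1 in p1 | p 2 in p2
upTo2-sound p ok z≤n             | true | true | true = p0
upTo2-sound p ok (s≤s z≤n)       | true | true | true = p1
upTo2-sound p ok (s≤s (s≤s z≤n)) | true | true | true = p2

allSmall-sound : ∀ p → allSmall p ≡ true → ∀ {x} → Small x → p x ≡ true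
allSmall-sound p ok {x₁ , x₂ , x₃} (s₁ , s₂ , s₃) =
  upTo2-sound (λ y₃ → p (x₁ , x₂ , y₃))
    (upTo2-sound (λ y₂ → upTo2 λ y₃ → p (x₁ , y₂ , y₃))
      (upTo2-sound (λ y₁ → upTo2 λ y₂ → upTo2 λ y₃ → p (y₁ , y₂ , y₃)) ok s₁) s₂) s₃

-- Let x, y, z be the weights from three vertices to the vertices of a triangle (u₁ , u₂ , u₃).
-- Then f is tested on the products belonging to the two triples {x , y , uᵢ} and {z , uⱼ , uₖ}.
-- If the third pair of a triple is adjacent, the triple is a triangle when its product is
-- positive, and contains T₃ when its product is at least 2.
exchange : (ℕ → ℕ → Bool) → W → W → W → Bool
exchange f (x₁ , x₂ , x₃) (y₁ , y₂ , y₃) (z₁ , z₂ , z₃) =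
  f (x₁ * y₁) (z₂ * z₃) ∨ f (x₂ * y₂) (z₁ * z₃) ∨ f (x₃ * y₃) (z₁ * z₂)

-- In `oneT₃`, a product of at least 2 means that both factors are positive and one is at least 2:
-- one triple contains T₃ and the other is at least a triangle.
bothT₃ oneT₃ : ℕ → ℕ → Bool
bothT₃ p q = (2 ≤ᵇ p) ∧ (2 ≤ᵇ q)
oneT₃  p q = 2 ≤ᵇ p * q

-- The three exchanges differ in which of the three vertices is sent to an edge of the tile.
cyclicCheck : W → W → W → Bool
cyclicCheck x y z =
  (size x + (size y + size z) ≤ᵇ 12) ∨
  exchange bothT₃ x y z ∨ exchange bothT₃ x z y ∨ exchange bothT₃ y z x

-- For a path c b a t and a pair that forms a T₃ with each of a, c and t, each disjunct leaves one of
-- a, c, t to the pair and regroups the other vertices with the u's.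
gadgetCheck₄ : W → W → W → W → Bool
gadgetCheck₄ b t a c =
  (2 * (size b + size t) + (size a + size c) ≤ᵇ 24) ∨
  exchange oneT₃ c b a ∨ exchange oneT₃ a b c ∨ exchange oneT₃ c b t

-- The two exchanges that leave c to the pair do not involve the weights of c. Testing them first
-- means that c is enumerated only where both fail.
gadgetCheck : W → W → W → Bool
gadgetCheck b t a = exchange oneT₃ a b t ∨ exchange oneT₃ a t b ∨ allSmall (gadgetCheck₄ b t a)

-- Evaluation over all 27 ^ 3 triples of weight vectors.
cyclicCheck-all : allSmall (λ x → allSmall λ y → allSmall (cyclicCheck x y)) ≡ true
cyclicCheck-all = refl

gadgetCheck-all : allSmall (λ b → allSmall λ t → allSmall (gadgetCheck b t)) ≡ true
gadgetCheck-all = refl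

∨-split : ∀ {p q} → p ∨ q ≡ true → T p ⊎ q ≡ true
∨-split {true}  _  = inj₁ _
∨-split {false} ok = inj₂ ok

≡⇒T : ∀ {p} → p ≡ true → T p
≡⇒T = Equivalence.from T-≡

cyclic-exchange : ∀ x y z → Small x → Small y → Small z → 12 < size x + (size y + size z) →
  T (exchange bothT₃ x y z) ⊎ T (exchange bothT₃ x z y) ⊎ T (exchange bothT₃ y z x)
cyclic-exchange x y z sx sy sz large
  with ∨-split (allSmall-sound (cyclicCheck x y)
         (allSmall-sound (λ y → allSmall (cyclicCheck x y))
           (allSmall-sound (λ x → allSmall λ y → allSmall (cyclicCheck x y)) cyclicCheck-all sx) sy) sz)
... | inj₁ small = contradiction (≤ᵇ⇒≤ _ 12 small) (<⇒≱ large)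
... | inj₂ ok with ∨-split ok
...   | inj₁ e = inj₁ e
...   | inj₂ ok with ∨-split ok
...     | inj₁ e = inj₂ (inj₁ e)
...     | inj₂ e = inj₂ (inj₂ (≡⇒T e))

gadget-exchange : ∀ b t a c → Small b → Small t → Small a → Small c →
  24 < 2 * (size b + size t) + (size a + size c) →
  T (exchange oneT₃ a b t) ⊎ T (exchange oneT₃ a t b) ⊎
  T (exchange oneT₃ c b a) ⊎ T (exchange oneT₃ a b c) ⊎ T (exchange oneT₃ c b t)
gadget-exchange b t a c sb st sa sc large
  with ∨-split (allSmall-sound (gadgetCheck b t)
         (allSmall-sound (λ t → allSmall (gadgetCheck b t))
           (allSmall-sound (λ b → allSmall λ t → allSmall (gadgetCheck b t)) gadgetCheck-all sb) st) sa)
... | inj₁ e = inj₁ e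
... | inj₂ ok with ∨-split ok
...   | inj₁ e = inj₂ (inj₁ e)
...   | inj₂ ok with ∨-split (allSmall-sound (gadgetCheck₄ b t a) ok sc)
...     | inj₁ small = contradiction (≤ᵇ⇒≤ _ 24 small) (<⇒≱ large)
...     | inj₂ ok with ∨-split ok
...       | inj₁ e = inj₂ (inj₂ (inj₁ e))
...       | inj₂ ok with ∨-split ok
...         | inj₁ e = inj₂ (inj₂ (inj₂ (inj₁ e)))
...         | inj₂ e = inj₂ (inj₂ (inj₂ (inj₂ (≡⇒T e))))

-- Arithmetic of weights at most 2.

3≤+⇒2≤* : ∀ {x y} → x ≤ 2 → y ≤ 2 → 3 ≤ x + y → 2 ≤ x * y
3≤+⇒2≤* {0} _ (s≤s (s≤s ())) (s≤s (s≤s (s≤s _)))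
3≤+⇒2≤* {1} {1} _ _ (s≤s (s≤s ()))
3≤+⇒2≤* {1} {2} _ _ _ = s≤s (s≤s z≤n)
3≤+⇒2≤* {2} {1} _ _ _ = s≤s (s≤s z≤n)
3≤+⇒2≤* {2} {2} _ _ _ = s≤s (s≤s z≤n)
3≤+⇒2≤* {2} {0} _ _ (s≤s (s≤s ()))
3≤+⇒2≤* {1} {0} _ _ (s≤s ())
3≤+⇒2≤* {x} {suc (suc (suc y))} _ (s≤s (s≤s ())) _
3≤+⇒2≤* {suc (suc (suc x))} (s≤s (s≤s ())) _ _

-- Dropping any one summand, which is at most 2, leaves a sum of at least 3.
5≤+⇒2≤* : ∀ {x y z} → x ≤ 2 → y ≤ 2 → z ≤ 2 → 5 ≤ x + (y + (z + 0)) → 2 ≤ x * y × 2 ≤ x * z × 2 ≤ y * z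
5≤+⇒2≤* {x} {y} {z} x≤2 y≤2 z≤2 5≤ =
  3≤+⇒2≤* x≤2 y≤2 (+-cancelʳ-≤ 2 3 (x + y) (≤-trans (subst (5 ≤_) (xy-z x y z) 5≤) (+-monoʳ-≤ (x + y) z≤2))) ,
  3≤+⇒2≤* x≤2 z≤2 (+-cancelʳ-≤ 2 3 (x + z) (≤-trans (subst (5 ≤_) (xz-y x y z) 5≤) (+-monoʳ-≤ (x + z) y≤2))) ,
  3≤+⇒2≤* y≤2 z≤2 (+-cancelʳ-≤ 2 3 (y + z) (≤-trans (subst (5 ≤_) (yz-x x y z) 5≤) (+-monoʳ-≤ (y + z) x≤2)))
  where
  xy-z : ∀ x y z → x + (y + (z + 0)) ≡ x + y + z
  xy-z = solve-∀
  xz-y : ∀ x y z → x + (y + (z + 0)) ≡ x + z + y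
  xz-y = solve-∀
  yz-x : ∀ x y z → x + (y + (z + 0)) ≡ y + z + x
  yz-x = solve-∀

2≤*⇒2≤ : ∀ x y → 2 ≤ x * y → 2 ≤ x ⊎ 2 ≤ y
2≤*⇒2≤ 0 y ()
2≤*⇒2≤ 1 y p = inj₂ (subst (2 ≤_) (+-identityʳ y) p)
2≤*⇒2≤ (suc (suc x)) y p = inj₁ (s≤s (s≤s z≤n))

1≤*⇒1≤ : ∀ x y → 1 ≤ x * y → 1 ≤ x × 1 ≤ y
1≤*⇒1≤ (suc x) (suc y) _ = s≤s z≤n , s≤s z≤n
1≤*⇒1≤ (suc x) zero p = contradiction (subst (1 ≤_) (*-zeroʳ x) p) λ ()

-- Degrees and the degree condition.

length-filterᵇ : ∀ {A : Set} (p : A → Bool) xs →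
  length (filterᵇ p xs) ≡ ∑ (λ x → if p x then 1 else 0) xs
length-filterᵇ p [] = refl
length-filterᵇ p (x ∷ xs) with p x
... | true  = cong suc (length-filterᵇ p xs)
... | false = length-filterᵇ p xs

-- The degree condition multiplied by 3, with the subtracted term moved across to avoid truncated
-- subtraction.
Ore : ∀ {n} → Digraph n → Set
Ore {n} G = ∀ (x y : Fin n) → ¬ (x ≡ y) → ¬ Edge G x y → 3 * (outdeg G x + indeg G y) + 3 ≥ 4 * n

-- Weights, triangles and copies of T₃ in a digraph.

module _ {n : ℕ} (G : Digraph n) where

  private V = Fin n

  [_⟶_] : V → V → ℕ
  [ x ⟶ y ] = if adj G x y then 1 else 0

  w : V → V → ℕ
  w x y = [ x ⟶ y ] + [ y ⟶ x ]

  Adjacent : V → V → Set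
  Adjacent x y = 1 ≤ w x y

  edge? : ∀ x y → Edge G x y ⊎ ¬ Edge G x y
  edge? x y with adj G x y
  ... | true  = inj₁ refl
  ... | false = inj₂ λ ()

  [⟶]≤1 : ∀ x y → [ x ⟶ y ] ≤ 1
  [⟶]≤1 x y with adj G x y
  ... | true  = ≤-refl
  ... | false = z≤n

  edge⇒[⟶]≡1 : ∀ {x y} → Edge G x y → [ x ⟶ y ] ≡ 1
  edge⇒[⟶]≡1 e rewrite e = refl

  ¬edge⇒[⟶]≡0 : ∀ {x y} → ¬ Edge G x y → [ x ⟶ y ] ≡ 0
  ¬edge⇒[⟶]≡0 {x} {y} ¬e with adj G x y
  ... | true  = contradiction refl ¬e
  ... | false = refl

  w≤2 : ∀ x y → w x y ≤ 2
  w≤2 x y = +-mono-≤ ([⟶]≤1 x y) ([⟶]≤1 y x)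

  w-sym : ∀ x y → w x y ≡ w y x
  w-sym x y = +-comm [ x ⟶ y ] [ y ⟶ x ]

  w-refl : ∀ x → w x x ≡ 0
  w-refl x rewrite noLoops G x = refl

  edge⇒adjacent : ∀ {x y} → Edge G x y → Adjacent x y
  edge⇒adjacent {x} {y} e = ≤-trans (≤-reflexive (sym (edge⇒[⟶]≡1 e))) (m≤m+n _ _)

  adjacent-sym : ∀ {x y} → Adjacent x y → Adjacent y x
  adjacent-sym {x} {y} = subst (1 ≤_) (w-sym x y)

  adjacent⇒edge : ∀ {x y} → Adjacent x y → Edge G x y ⊎ Edge G y x
  adjacent⇒edge {x} {y} a with adj G x y | adj G y x
  ... | true  | _     = inj₁ refl
  ... | false | true  = inj₂ refl
  adjacent⇒edge () | false | false

  reversed : ∀ {x y} → Adjacent x y → ¬ Edge G x y → Edge G y x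
  reversed a x↛y = [ (λ e → contradiction e x↛y) , (λ e → e) ]′ (adjacent⇒edge a)

  adjacent⇒≢ : ∀ {x y} → Adjacent x y → x ≢ y
  adjacent⇒≢ {x} a refl = contradiction (subst (1 ≤_) (w-refl x) a) λ ()

  w≡0⇒¬edge : ∀ {x y} → w x y ≡ 0 → ¬ Edge G x y
  w≡0⇒¬edge w≡0 e = contradiction (subst (1 ≤_) w≡0 (edge⇒adjacent e)) λ ()

  zero-or-adjacent : ∀ x y → w x y ≡ 0 ⊎ Adjacent x y
  zero-or-adjacent x y with w x y
  ... | zero  = inj₁ refl
  ... | suc _ = inj₂ (s≤s z≤n)

  Triangle : V → V → V → Set
  Triangle x y z = Adjacent x y × Adjacent y z × Adjacent x z

  double⇒edge : ∀ {x y} → 2 ≤ w x y → Edge G x y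
  double⇒edge {x} {y} d with adj G x y
  ... | true  = refl
  ... | false = contradiction (≤-trans d ([⟶]≤1 y x)) λ { (s≤s ()) }

  total : (V → ℕ) → ℕ
  total F = ∑ F (allFin n)

  total-w : ∀ x → total (w x) ≡ outdeg G x + indeg G x
  total-w x = trans (∑-+ [ x ⟶_] [_⟶ x ] (allFin n))
    (sym (cong₂ _+_ (length-filterᵇ (adj G x) (allFin n)) (length-filterᵇ (λ y → adj G y x) (allFin n))))

  -- The permutation hides the order of the copy of T₃, so tiles can be treated as unordered
  -- triples.
  Tile : List V → Set
  Tile xs = ∃[ a ] ∃[ b ] ∃[ c ] IsT3 G a b c × a ∷ b ∷ c ∷ [] ↭ xs

  Tile-resp-↭ : ∀ {xs ys} → xs ↭ ys → Tile xs → Tile ys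
  Tile-resp-↭ p (a , b , c , t , q) = a , b , c , t , ↭-trans q p

  -- Either direction of an edge between x and y completes a transitive triple starting at s.
  source : ∀ {s x y} → Edge G s x → Edge G s y → Adjacent x y → Tile (s ∷ x ∷ y ∷ [])
  source {s} {x} {y} sx sy xy with adjacent⇒edge xy
  ... | inj₁ e = s , x , y , (sx , e , sy) , ↭-refl
  ... | inj₂ e = s , y , x , (sy , e , sx) , prep s (swap y x ↭-refl)

  -- As both edges between x and y are present, an edge from x or y to z makes its tail a source;
  -- otherwise z sends edges to both.
  double-tile : ∀ {x y z} → 2 ≤ w x y → Adjacent x z → Adjacent y z → Tile (x ∷ y ∷ z ∷ [])
  double-tile {x} {y} {z} d xz yz with adjacent⇒edge xz | adjacent⇒edge yz
  ... | inj₁ x→z | _        = source (double⇒edge d) x→z yz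
  ... | inj₂ z→x | inj₁ y→z = Tile-resp-↭ (swap y x ↭-refl)
    (source (double⇒edge (subst (2 ≤_) (w-sym x y) d)) y→z xz)
  ... | inj₂ z→x | inj₂ z→y = Tile-resp-↭ (select-↭ (1 ∷ 2 ∷ []) _) (source z→x z→y (≤-trans (s≤s z≤n) d))

  -- Both factors are positive and one is 2, so the triple is a triangle with a double edge.
  product-tile : ∀ {x y z} → Adjacent x y → 2 ≤ w x z * w y z → Tile (x ∷ y ∷ z ∷ [])
  product-tile {x} {y} {z} xy d with 1≤*⇒1≤ (w x z) (w y z) (≤-trans (s≤s z≤n) d) | 2≤*⇒2≤ (w x z) (w y z) d
  ... | xz , yz | inj₁ xz² = Tile-resp-↭ (prep x (swap z y ↭-refl)) (double-tile xz² xy (adjacent-sym yz))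
  ... | xz , yz | inj₂ yz² = Tile-resp-↭ (select-↭ (2 ∷ 0 ∷ []) _)
    (double-tile yz² (adjacent-sym xy) (adjacent-sym xz))

  product-tileˡ : ∀ {x y z} → Adjacent y z → 2 ≤ w x y * w x z → Tile (x ∷ y ∷ z ∷ [])
  product-tileˡ {x} {y} {z} yz d = Tile-resp-↭ (select-↭ (2 ∷ []) _)
    (product-tile yz (subst (2 ≤_) (cong₂ _*_ (w-sym x y) (w-sym x z)) d))

  NonedgeCycle : V → V → V → Set
  NonedgeCycle x y z = ¬ Edge G x y × ¬ Edge G y z × ¬ Edge G z x

  -- If no vertex sends edges to both others, the edges are single and form a directed cycle. The
  -- last two alternatives list the missing reverse edges, one for each orientation, since the
  -- degree condition speaks of nonedges.
  triangle-cases : ∀ {x y z} → Adjacent x y → Adjacent y z → Adjacent x z →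
    Tile (x ∷ y ∷ z ∷ []) ⊎ NonedgeCycle x y z ⊎ NonedgeCycle z y x
  triangle-cases {x} {y} {z} xy yz xz with edge? x y
  triangle-cases {x} {y} {z} xy yz xz | inj₁ x→y with edge? x z | edge? z y | edge? y x
  ... | inj₁ x→z | _        | _        = inj₁ (source x→y x→z yz)
  ... | inj₂ x↛z | inj₁ z→y | _        =
    inj₁ (Tile-resp-↭ (select-↭ (1 ∷ 2 ∷ []) _) (source (reversed xz x↛z) z→y xy))
  ... | inj₂ x↛z | inj₂ z↛y | inj₁ y→x =
    inj₁ (Tile-resp-↭ (swap y x ↭-refl) (source y→x (reversed (adjacent-sym yz) z↛y) xz))
  ... | inj₂ x↛z | inj₂ z↛y | inj₂ y↛x = inj₂ (inj₂ (z↛y , y↛x , x↛z))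
  triangle-cases {x} {y} {z} xy yz xz | inj₂ x↛y with edge? y z | edge? z x
  ... | inj₁ y→z | _        = inj₁ (Tile-resp-↭ (swap y x ↭-refl) (source (reversed xy x↛y) y→z xz))
  ... | inj₂ y↛z | inj₁ z→x =
    inj₁ (Tile-resp-↭ (select-↭ (1 ∷ 2 ∷ []) _) (source z→x (reversed yz y↛z) xy))
  ... | inj₂ y↛z | inj₂ z↛x = inj₂ (inj₁ (x↛y , y↛z , z↛x))

  -- Partial covers by tiles.

  record Cover (xs : List V) : Set where
    constructor cover
    field
      tiles   : List (V × V × V)
      tiles-T₃ : All (λ (a , b , c) → IsT3 G a b c) tiles
      -- One permutation states disjointness and covering together; `xs` holds the vertices left
      -- over, so `Cover []` amounts to a T₃-factor.
      partition : xs ++ flat tiles ↭ allFin n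

  open Cover

  reorder : ∀ {xs ys} → xs ↭ ys → Cover xs → Cover ys
  reorder p (cover ts t₃ q) = cover ts t₃ (↭-trans (++⁺ʳ (flat ts) (↭-sym p)) q)

  -- On an explicit list `select is xs` normalizes to the wanted order, so each regrouping below is
  -- given by numerals alone.
  rearrange : ∀ {xs} is → Cover xs → Cover (select is xs)
  rearrange is = reorder (select-↭ is _)

  addTile : ∀ {x y z xs} → Tile (x ∷ y ∷ z ∷ []) → Cover (x ∷ y ∷ z ∷ xs) → Cover xs
  addTile {x} {y} {z} {xs} (a , b , c , t , p) (cover ts t₃ q) = cover ((a , b , c) ∷ ts) (t ∷ t₃)
    (↭-trans (shifts xs (a ∷ b ∷ c ∷ [])) (↭-trans (++⁺ʳ (xs ++ flat ts) p) q))

  cover-size : ∀ {xs} (C : Cover xs) → length xs + 3 * length (tiles C) ≡ n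
  cover-size {xs} (cover ts _ p) = trans (cong (length xs +_) (sym (length-flat ts)))
    (trans (sym (length-++ xs)) (trans (↭-length p) (length-tabulate {n = n} (λ i → i))))

  cover-unique : ∀ {xs} (C : Cover xs) → Unique (xs ++ flat (tiles C))
  cover-unique (cover ts _ p) = Unique-resp-↭ (≡-setoid V) (↭⇒↭ₛ (↭-sym p)) (allFin⁺ n)

  -- Averaging over the tiles. The heavy tile is dissolved, and its vertices join the uncovered
  -- ones.
  heavyTile : ∀ F c {xs} (C : Cover xs) → ∑ F xs + c * length (tiles C) < total F →
    ∃[ u₁ ] ∃[ u₂ ] ∃[ u₃ ] IsT3 G u₁ u₂ u₃ × c < ∑ F (u₁ ∷ u₂ ∷ u₃ ∷ []) × Cover (u₁ ∷ u₂ ∷ u₃ ∷ xs)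
  heavyTile F c {xs} (cover ts t₃ p) large with ∑-flat-pigeonhole F c ts
  ... | inj₂ (u₁ , u₂ , u₃ , us , q , c<u) with All-resp-↭ q t₃
  ...   | u-T₃ ∷ us-T₃ = u₁ , u₂ , u₃ , u-T₃ , c<u , cover us us-T₃
          (↭-trans (shifts (u₁ ∷ u₂ ∷ u₃ ∷ []) xs) (↭-trans (++⁺ˡ xs (↭-sym (flat-↭ q))) p))
  heavyTile F c {xs} (cover ts t₃ p) large | inj₁ few = contradiction large (≤⇒≯ (begin
    total F                        ≡⟨ ∑-↭ F p ⟨
    ∑ F (xs ++ flat ts)            ≡⟨ ∑-++ F xs (flat ts) ⟩
    ∑ F xs + ∑ F (flat ts)         ≤⟨ +-monoʳ-≤ (∑ F xs) few ⟩
    ∑ F xs + c * length ts         ∎))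
    where open ≤-Reasoning

  weights : V → V → V → V → W
  weights u₁ u₂ u₃ x = w x u₁ , w x u₂ , w x u₃

  weights-small : ∀ u₁ u₂ u₃ x → Small (weights u₁ u₂ u₃ x)
  weights-small u₁ u₂ u₃ x = w≤2 x u₁ , w≤2 x u₂ , w≤2 x u₃

  -- The disjunct that holds names the vertex u that joins x and y; the other two, v and v′, join z.
  exchange-sound : ∀ f {u₁ u₂ u₃ x y z} → Adjacent u₁ u₂ → Adjacent u₂ u₃ → Adjacent u₁ u₃ →
    let U = weights u₁ u₂ u₃ in T (exchange f (U x) (U y) (U z)) →
    ∃[ u ] ∃[ v ] ∃[ v′ ] Adjacent v v′ × T (f (w x u * w y u) (w z v * w z v′)) ×
      u₁ ∷ u₂ ∷ u₃ ∷ [] ↭ u ∷ v ∷ v′ ∷ []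
  exchange-sound f {u₁} {u₂} {u₃} a₁₂ a₂₃ a₁₃ e with Equivalence.to T-∨ e
  ... | inj₁ e = u₁ , u₂ , u₃ , a₂₃ , e , ↭-refl
  ... | inj₂ e with Equivalence.to T-∨ e
  ...   | inj₁ e = u₂ , u₁ , u₃ , a₁₃ , e , select-↭ (1 ∷ []) _
  ...   | inj₂ e = u₃ , u₁ , u₂ , a₁₂ , e , select-↭ (2 ∷ []) _

  -- Degree sums and uncovered triangles.

  module _ (ore : Ore G) where

    -- For n = 3k the bound 4n/3 - 1 is 4k - 1, and `suc` absorbs the subtracted 1.
    ore′ : ∀ {x y} k → n ≡ 3 * k → x ≢ y → ¬ Edge G x y → 4 * k ≤ suc (outdeg G x + indeg G y)
    ore′ {x} {y} k n≡3k x≢y x↛y = *-cancelˡ-≤ 3 (begin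
      3 * (4 * k)                             ≡⟨ 34k k ⟩
      4 * (3 * k)                             ≡⟨ cong (4 *_) n≡3k ⟨
      4 * n                                   ≤⟨ ore x y x≢y x↛y ⟩
      3 * (outdeg G x + indeg G y) + 3        ≡⟨ 3d+3 (outdeg G x + indeg G y) ⟩
      3 * suc (outdeg G x + indeg G y)        ∎)
      where
      open ≤-Reasoning
      34k : ∀ k → 3 * (4 * k) ≡ 4 * (3 * k)
      34k = solve-∀
      3d+3 : ∀ d → 3 * d + 3 ≡ 3 * suc d
      3d+3 = solve-∀

    -- Around the directed cycle of nonedges each vertex is once a tail and once a head, so every
    -- out-degree and in-degree occurs once.
    cycle-degrees : ∀ {x y z} k → n ≡ 3 * k → x ≢ y → y ≢ z → z ≢ x → NonedgeCycle x y z →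
      12 * k ≤ total (λ v → w x v + (w y v + w z v)) + 3
    cycle-degrees {x} {y} {z} k n≡3k x≢y y≢z z≢x (x↛y , y↛z , z↛x) = begin
      12 * k                     ≡⟨ 12k k ⟩
      4 * k + (4 * k + 4 * k)    ≤⟨ +-mono-≤ (ore′ k n≡3k x≢y x↛y)
                                      (+-mono-≤ (ore′ k n≡3k y≢z y↛z) (ore′ k n≡3k z≢x z↛x)) ⟩
      suc (outdeg G x + indeg G y) + (suc (outdeg G y + indeg G z) + suc (outdeg G z + indeg G x))
                                 ≡⟨ regroup (outdeg G x) (indeg G y) (outdeg G y) (indeg G z) _ _ ⟩
      outdeg G x + indeg G x + (outdeg G y + indeg G y + (outdeg G z + indeg G z)) + 3
                                 ≡⟨ cong (_+ 3) (cong₂ _+_ (total-w x) (cong₂ _+_ (total-w y) (total-w z))) ⟨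
      total (w x) + (total (w y) + total (w z)) + 3
                                 ≡⟨ cong (_+ 3) (∑-+₃ (w x) (w y) (w z) (allFin n)) ⟨
      total (λ v → w x v + (w y v + w z v)) + 3 ∎
      where
      open ≤-Reasoning
      12k : ∀ k → 12 * k ≡ 4 * k + (4 * k + 4 * k)
      12k = solve-∀
      regroup : ∀ a b′ b c′ c a′ →
        suc (a + b′) + (suc (b + c′) + suc (c + a′)) ≡ a + a′ + (b + b′ + (c + c′)) + 3
      regroup = solve-∀

    cyclic-split : ∀ {u₁ u₂ u₃ x y z} → IsT3 G u₁ u₂ u₃ → Adjacent x y →
      let U = weights u₁ u₂ u₃ in T (exchange bothT₃ (U x) (U y) (U z)) →
      Cover (u₁ ∷ u₂ ∷ u₃ ∷ x ∷ y ∷ z ∷ []) → Cover []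
    cyclic-split {u₁} {u₂} {u₃} {x} {y} {z} (e₁₂ , e₂₃ , e₁₃) xy e C
      with exchange-sound bothT₃ {u₁} {u₂} {u₃} {x} {y} {z}
             (edge⇒adjacent e₁₂) (edge⇒adjacent e₂₃) (edge⇒adjacent e₁₃) e
    ... | u , v , v′ , vv′ , both , p with Equivalence.to T-∧ both
    ...   | 2≤P , 2≤Q =
      addTile (product-tileˡ vv′ (≤ᵇ⇒≤ 2 _ 2≤Q))
        (addTile (product-tile xy (≤ᵇ⇒≤ 2 _ 2≤P)) (rearrange (3 ∷ 3 ∷ 0 ∷ 2 ∷ []) (reorder (++⁺ʳ _ p) C)))

    cyclic-heavy : ∀ {x y z u₁ u₂ u₃} → Adjacent x y → Adjacent y z → Adjacent x z → IsT3 G u₁ u₂ u₃ →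
      12 < ∑ (λ v → w x v + (w y v + w z v)) (u₁ ∷ u₂ ∷ u₃ ∷ []) →
      Cover (u₁ ∷ u₂ ∷ u₃ ∷ x ∷ y ∷ z ∷ []) → Cover []
    cyclic-heavy {x} {y} {z} {u₁} {u₂} {u₃} xy yz xz t large C =
      [ (λ e → cyclic-split {z = z} t xy e C)
      , [ (λ e → cyclic-split {z = y} t xz e (rearrange (0 ∷ 0 ∷ 0 ∷ 0 ∷ 1 ∷ []) C))
        , (λ e → cyclic-split {z = x} t yz e (rearrange (0 ∷ 0 ∷ 0 ∷ 1 ∷ 1 ∷ []) C)) ]′ ]′
      (cyclic-exchange (U x) (U y) (U z) (S x) (S y) (S z)
        (<-≤-trans large (≤-reflexive (∑-+₃ (w x) (w y) (w z) (u₁ ∷ u₂ ∷ u₃ ∷ [])))))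
      where
      U = weights u₁ u₂ u₃
      S = weights-small u₁ u₂ u₃

    cyclic-cover : ∀ {x y z} → Adjacent x y → Adjacent y z → Adjacent x z → NonedgeCycle x y z →
      Cover (x ∷ y ∷ z ∷ []) → Cover []
    cyclic-cover {x} {y} {z} xy yz xz cyc@(x↛y , y↛z , z↛x) C = finish (heavyTile F 12 C large)
      where
      F : V → ℕ
      F v = w x v + (w y v + w z v)

      finish : ∃[ u₁ ] ∃[ u₂ ] ∃[ u₃ ] IsT3 G u₁ u₂ u₃ × 12 < ∑ F (u₁ ∷ u₂ ∷ u₃ ∷ []) ×
        Cover (u₁ ∷ u₂ ∷ u₃ ∷ x ∷ y ∷ z ∷ []) → Cover []
      finish (_ , _ , _ , t , big , D) = cyclic-heavy xy yz xz t big D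

      m = length (tiles C)

      n≡ : n ≡ 3 * suc m
      n≡ = trans (sym (cover-size C)) (sym (*-suc 3 m))

      w≤1 : ∀ {a b} → ¬ Edge G a b → w a b ≤ 1
      w≤1 {a} {b} a↛b = subst (λ d → d + [ b ⟶ a ] ≤ 1) (sym (¬edge⇒[⟶]≡0 a↛b)) ([⟶]≤1 b a)

      w≤1′ : ∀ {a b} → ¬ Edge G a b → w b a ≤ 1
      w≤1′ {a} {b} a↛b = subst (_≤ 1) (w-sym a b) (w≤1 a↛b)

      -- Three pairs of weight at most 1, each counted from both ends.
      inside : ∑ F (x ∷ y ∷ z ∷ []) ≤ 6
      inside = +-mono-≤ (+-mono-≤ (≤-reflexive (w-refl x)) (+-mono-≤ (w≤1′ x↛y) (w≤1 z↛x)))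
        (+-mono-≤ (+-mono-≤ (w≤1 x↛y) (+-mono-≤ (≤-reflexive (w-refl y)) (w≤1′ y↛z)))
        (+-monoˡ-≤ 0 (+-mono-≤ (w≤1′ z↛x) (+-mono-≤ (w≤1 y↛z) (≤-reflexive (w-refl z))))))

      -- The degree sum is at least 12 (m + 1) - 3 = 12 m + 9, which exceeds 6 + 12 m.
      large : ∑ F (x ∷ y ∷ z ∷ []) + 12 * m < total F
      large = +-cancelʳ-< 3 _ _ (begin-strict
        ∑ F (x ∷ y ∷ z ∷ []) + 12 * m + 3    ≤⟨ +-monoˡ-≤ 3 (+-monoˡ-≤ (12 * m) inside) ⟩
        6 + 12 * m + 3                       <⟨ +-monoˡ-< 3 (+-monoˡ-< (12 * m) (<ᵇ⇒< 6 9 _)) ⟩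
        9 + 12 * m + 3                       ≡⟨ 12+12m m ⟩
        12 * suc m                           ≤⟨ cycle-degrees (suc m) n≡
                                                  (adjacent⇒≢ xy) (adjacent⇒≢ yz) (adjacent⇒≢ (adjacent-sym xz)) cyc ⟩
        total F + 3                          ∎)
        where
        open ≤-Reasoning
        12+12m : ∀ m → 9 + 12 * m + 3 ≡ 12 * suc m
        12+12m = solve-∀

    triangle-cover : ∀ {x y z} → Adjacent x y → Adjacent y z → Adjacent x z → Cover (x ∷ y ∷ z ∷ []) → Cover []
    triangle-cover xy yz xz C with triangle-cases xy yz xz
    ... | inj₁ t          = addTile t C
    ... | inj₂ (inj₁ cyc) = cyclic-cover xy yz xz cyc C
    ... | inj₂ (inj₂ cyc) = cyclic-cover (adjacent-sym yz) (adjacent-sym xy) (adjacent-sym xz) cyc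
                              (rearrange (2 ∷ 1 ∷ []) C)

    -- The six-vertex gadget.

    gadget-split : ∀ {u₁ u₂ u₃ x y z} → IsT3 G u₁ u₂ u₃ → Adjacent x y →
      let U = weights u₁ u₂ u₃ in T (exchange oneT₃ (U x) (U y) (U z)) →
      Cover (u₁ ∷ u₂ ∷ u₃ ∷ x ∷ y ∷ z ∷ []) → Cover []
    gadget-split {u₁} {u₂} {u₃} {x} {y} {z} (e₁₂ , e₂₃ , e₁₃) xy e C
      with exchange-sound oneT₃ {u₁} {u₂} {u₃} {x} {y} {z}
             (edge⇒adjacent e₁₂) (edge⇒adjacent e₂₃) (edge⇒adjacent e₁₃) e
    ... | u , v , v′ , vv′ , 2≤ᵇPQ , p = finish
      (2≤*⇒2≤ (w x u * w y u) (w z v * w z v′) 2≤PQ)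
      where
      2≤PQ : 2 ≤ w x u * w y u * (w z v * w z v′)
      2≤PQ = ≤ᵇ⇒≤ 2 _ 2≤ᵇPQ

      1≤P×1≤Q : 1 ≤ w x u * w y u × 1 ≤ w z v * w z v′
      1≤P×1≤Q = 1≤*⇒1≤ (w x u * w y u) (w z v * w z v′) (≤-trans (s≤s z≤n) 2≤PQ)

      D : Cover (x ∷ y ∷ u ∷ v ∷ v′ ∷ z ∷ [])
      D = rearrange (3 ∷ 3 ∷ []) (reorder (++⁺ʳ (x ∷ y ∷ z ∷ []) p) C)

      -- The triple whose product is at least 2 becomes a tile; the other is a triangle, left to
      -- `triangle-cover`.
      finish : 2 ≤ w x u * w y u ⊎ 2 ≤ w z v * w z v′ → Cover []
      finish (inj₁ 2≤P) with 1≤*⇒1≤ (w z v) (w z v′) (proj₂ 1≤P×1≤Q)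
      ... | zv , zv′ = triangle-cover vv′ (adjacent-sym zv′) (adjacent-sym zv) (addTile (product-tile xy 2≤P) D)
      finish (inj₂ 2≤Q) with 1≤*⇒1≤ (w x u) (w y u) (proj₁ 1≤P×1≤Q)
      ... | xu , yu = triangle-cover xy yu xu
        (addTile (product-tileˡ vv′ 2≤Q) (rearrange (5 ∷ 3 ∷ 3 ∷ []) D))

    -- In each of the five exchanges two neighbours on the path c b a t share one vertex of the
    -- heavy tile, a third path vertex takes the other two, and the fourth completes p, q to a T₃.
    gadget-heavy : ∀ {a b c t p q u₁ u₂ u₃} →
      Tile (a ∷ p ∷ q ∷ []) → Tile (c ∷ p ∷ q ∷ []) → Tile (t ∷ p ∷ q ∷ []) →
      Adjacent c b → Adjacent b a → Adjacent a t → IsT3 G u₁ u₂ u₃ →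
      24 < ∑ (λ v → 2 * (w b v + w t v) + (w a v + w c v)) (u₁ ∷ u₂ ∷ u₃ ∷ []) →
      Cover (u₁ ∷ u₂ ∷ u₃ ∷ a ∷ b ∷ c ∷ t ∷ p ∷ q ∷ []) → Cover []
    gadget-heavy {a} {b} {c} {t} {p} {q} {u₁} {u₂} {u₃} apq cpq tpq cb ba at T₃ large C =
      [ (λ e → gadget-split {z = t} T₃ (adjacent-sym ba) e (addTile cpq (rearrange (5 ∷ 6 ∷ 6 ∷ []) C)))
      , [ (λ e → gadget-split {z = b} T₃ at e (addTile cpq (rearrange (5 ∷ 6 ∷ 6 ∷ 0 ∷ 0 ∷ 0 ∷ 0 ∷ 1 ∷ []) C)))
      , [ (λ e → gadget-split {z = a} T₃ cb e (addTile tpq (rearrange (6 ∷ 6 ∷ 6 ∷ 0 ∷ 0 ∷ 0 ∷ 2 ∷ 1 ∷ []) C)))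
      , [ (λ e → gadget-split {z = c} T₃ (adjacent-sym ba) e (addTile tpq (rearrange (6 ∷ 6 ∷ 6 ∷ []) C)))
        , (λ e → gadget-split {z = t} T₃ cb e (addTile apq (rearrange (3 ∷ 6 ∷ 6 ∷ 0 ∷ 0 ∷ 0 ∷ 1 ∷ 0 ∷ []) C)))
        ]′ ]′ ]′ ]′
      (gadget-exchange (U b) (U t) (U a) (U c) (S b) (S t) (S a) (S c)
        (<-≤-trans large (≤-reflexive (∑-gadget (w b) (w t) (w a) (w c) (u₁ ∷ u₂ ∷ u₃ ∷ [])))))
      where
      U = weights u₁ u₂ u₃
      S = weights-small u₁ u₂ u₃

    -- The degree condition applies to both (x, y) and (y, x), which together use each in-degree and
    -- out-degree once.
    pair-degrees : ∀ {x y} k → n ≡ 3 * k → x ≢ y → w x y ≡ 0 → 8 * k ≤ total (w x) + total (w y) + 2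
    pair-degrees {x} {y} k n≡3k x≢y xy = begin
      8 * k                      ≡⟨ 8k k ⟩
      4 * k + 4 * k              ≤⟨ +-mono-≤ (ore′ k n≡3k x≢y (w≡0⇒¬edge xy))
                                      (ore′ k n≡3k (x≢y ∘ sym) (w≡0⇒¬edge (trans (w-sym y x) xy))) ⟩
      suc (outdeg G x + indeg G y) + suc (outdeg G y + indeg G x)
                                 ≡⟨ regroup (outdeg G x) (indeg G y) (outdeg G y) (indeg G x) ⟩
      outdeg G x + indeg G x + (outdeg G y + indeg G y) + 2
                                 ≡⟨ cong (_+ 2) (cong₂ _+_ (total-w x) (total-w y)) ⟨
      total (w x) + total (w y) + 2 ∎
      where
      open ≤-Reasoning
      8k : ∀ k → 8 * k ≡ 4 * k + 4 * k
      8k = solve-∀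
      regroup : ∀ a b′ b a′ → suc (a + b′) + suc (b + a′) ≡ a + a′ + (b + b′) + 2
      regroup = solve-∀

    -- The weight 2 on b and t makes 24 an upper bound for every tile that admits no exchange; with
    -- weight 1 throughout, a tile fully joined to a, c and t but not to b violates the bound 16.
    gadget-cover : ∀ {a b c t p q} →
      Tile (a ∷ p ∷ q ∷ []) → Tile (c ∷ p ∷ q ∷ []) → Tile (t ∷ p ∷ q ∷ []) →
      Adjacent c b → Adjacent b a → Adjacent a t →
      w a c ≡ 0 → w b t ≡ 0 → w b p ≡ 0 → w b q ≡ 0 →
      Cover (a ∷ b ∷ c ∷ t ∷ p ∷ q ∷ []) → Cover []
    gadget-cover {a} {b} {c} {t} {p} {q} apq cpq tpq cb ba at ac bt bp bq C = finish (heavyTile F 24 C large)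
      where
      F : V → ℕ
      F v = 2 * (w b v + w t v) + (w a v + w c v)

      finish : ∃[ u₁ ] ∃[ u₂ ] ∃[ u₃ ] IsT3 G u₁ u₂ u₃ × 24 < ∑ F (u₁ ∷ u₂ ∷ u₃ ∷ []) ×
        Cover (u₁ ∷ u₂ ∷ u₃ ∷ a ∷ b ∷ c ∷ t ∷ p ∷ q ∷ []) → Cover []
      finish (_ , _ , _ , T₃ , big , D) = gadget-heavy apq cpq tpq cb ba at T₃ big D

      m = length (tiles C)

      F≤ : ∀ {v i j k l} → w b v ≤ i → w t v ≤ j → w a v ≤ k → w c v ≤ l → F v ≤ 2 * (i + j) + (k + l)
      F≤ i j k l = +-mono-≤ (*-monoʳ-≤ 2 (+-mono-≤ i j)) (+-mono-≤ k l)

      loop : ∀ {v} → w v v ≤ 0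
      loop {v} = ≤-reflexive (w-refl v)

      -- By the zero weights, a, c, p and q contribute at most 8 each, b and t at most 4 each.
      inside : ∑ F (a ∷ b ∷ c ∷ t ∷ p ∷ q ∷ []) ≤ 40
      inside = +-mono-≤ (F≤ (w≤2 b a) (w≤2 t a) loop (≤-reflexive (trans (w-sym c a) ac)))
        (+-mono-≤ (F≤ loop (≤-reflexive (trans (w-sym t b) bt)) (w≤2 a b) (w≤2 c b))
        (+-mono-≤ (F≤ (w≤2 b c) (w≤2 t c) (≤-reflexive ac) loop)
        (+-mono-≤ (F≤ (≤-reflexive bt) loop (w≤2 a t) (w≤2 c t))
        (+-mono-≤ (F≤ (≤-reflexive bp) (w≤2 t p) (w≤2 a p) (w≤2 c p))
        (+-monoˡ-≤ 0 (F≤ (≤-reflexive bq) (w≤2 t q) (w≤2 a q) (w≤2 c q)))))))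

      n≡ : n ≡ 3 * (2 + m)
      n≡ = trans (sym (cover-size C)) (6+3m m)
        where
        6+3m : ∀ m → 6 + 3 * m ≡ 3 * (2 + m)
        6+3m = solve-∀

      ac≢×bt≢ : a ≢ c × b ≢ t
      ac≢×bt≢ with cover-unique C
      ... | (_ ∷ a≢c ∷ _) ∷ (_ ∷ b≢t ∷ _) ∷ _ = a≢c , b≢t

      -- The nonadjacent pairs b, t (counted twice) and a, c give at least 24 (m + 2) - 6 = 24 m +
      -- 42, which exceeds 40 + 24 m.
      large : ∑ F (a ∷ b ∷ c ∷ t ∷ p ∷ q ∷ []) + 24 * m < total F
      large = +-cancelʳ-< 6 _ _ (begin-strict
        ∑ F (a ∷ b ∷ c ∷ t ∷ p ∷ q ∷ []) + 24 * m + 6   ≤⟨ +-monoˡ-≤ 6 (+-monoˡ-≤ (24 * m) inside) ⟩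
        40 + 24 * m + 6                                 <⟨ +-monoˡ-< 6 (+-monoˡ-< (24 * m) (<ᵇ⇒< 40 42 _)) ⟩
        42 + 24 * m + 6                                 ≡⟨ split m ⟩
        2 * (8 * (2 + m)) + 8 * (2 + m)                 ≤⟨ +-mono-≤
                                                             (*-monoʳ-≤ 2 (pair-degrees (2 + m) n≡ (proj₂ ac≢×bt≢) bt))
                                                             (pair-degrees (2 + m) n≡ (proj₁ ac≢×bt≢) ac) ⟩
        2 * (total (w b) + total (w t) + 2) + (total (w a) + total (w c) + 2)
                                                        ≡⟨ regroup (total (w b) + total (w t)) (total (w a) + total (w c)) ⟩
        2 * (total (w b) + total (w t)) + (total (w a) + total (w c)) + 6
                                                        ≡⟨ cong (_+ 6) (∑-gadget (w b) (w t) (w a) (w c) (allFin n)) ⟨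
        total F + 6                                     ∎)
        where
        open ≤-Reasoning
        split : ∀ m → 42 + 24 * m + 6 ≡ 2 * (8 * (2 + m)) + 8 * (2 + m)
        split = solve-∀
        regroup : ∀ x y → 2 * (x + 2) + (y + 2) ≡ 2 * x + y + 6
        regroup = solve-∀

    -- As a misses at most one of its six possible edges to p, q, t, it forms a T₃ with any two of
    -- them. If b is adjacent to t, the triangle a, b, t is left over; if b is adjacent to p or q,
    -- that vertex with b and c is. Otherwise all the gadget's conditions hold.
    gadget-start : ∀ {a b c p q t} → Adjacent a b → Adjacent b c → w a c ≡ 0 →
      Triangle p q t → Tile (p ∷ q ∷ t ∷ []) → Adjacent c p → Adjacent c q → Tile (c ∷ p ∷ q ∷ []) →
      5 ≤ ∑ (w a) (p ∷ q ∷ t ∷ []) → Cover (p ∷ q ∷ t ∷ a ∷ b ∷ c ∷ []) → Cover []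
    gadget-start {a} {b} {c} {p} {q} {t} ab bc ac (pq , qt , pt) pqt cp cq cpq a-full C
      with zero-or-adjacent b t | zero-or-adjacent b p | zero-or-adjacent b q
         | 5≤+⇒2≤* (w≤2 a p) (w≤2 a q) (w≤2 a t) a-full
    ... | inj₂ bt | _ | _ | _ , _ , aqt = triangle-cover ab bt
            (proj₂ (1≤*⇒1≤ (w a q) (w a t) (≤-trans (s≤s z≤n) aqt)))
            (addTile cpq (rearrange (5 ∷ 0 ∷ 0 ∷ 1 ∷ 1 ∷ 0 ∷ []) C))
    ... | inj₁ _ | inj₂ bp | _ | _ , _ , aqt = triangle-cover (adjacent-sym bc) bp cp
            (addTile (product-tileˡ qt aqt) (rearrange (3 ∷ 1 ∷ 1 ∷ 2 ∷ 1 ∷ 0 ∷ []) C))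
    ... | inj₁ _ | inj₁ _ | inj₂ bq | _ , apt , _ = triangle-cover (adjacent-sym bc) bq cq
            (addTile (product-tileˡ pt apt) (rearrange (3 ∷ 0 ∷ 1 ∷ 2 ∷ 1 ∷ 0 ∷ []) C))
    ... | inj₁ bt | inj₁ bp | inj₁ bq | apq , _ , aqt = gadget-cover (product-tileˡ pq apq) cpq
            (Tile-resp-↭ (select-↭ (2 ∷ 0 ∷ []) _) pqt)
            (adjacent-sym bc) (adjacent-sym ab) (proj₂ (1≤*⇒1≤ (w a q) (w a t) (≤-trans (s≤s z≤n) aqt)))
            ac bt bp bq (rearrange (3 ∷ 3 ∷ 3 ∷ 2 ∷ []) C)

    -- Replacing a vertex of a tile.

    Replaceable : V → V → V → V → Set
    Replaceable c t₁ t₂ t₃ = ∃[ p ] ∃[ q ] ∃[ t ] t₁ ∷ t₂ ∷ t₃ ∷ [] ↭ p ∷ q ∷ t ∷ [] × Triangle p q t ×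
      Adjacent c p × Adjacent c q × Tile (c ∷ p ∷ q ∷ [])

    T₃⇒triangle : ∀ {x y z} → IsT3 G x y z → Triangle x y z
    T₃⇒triangle (xy , yz , xz) = edge⇒adjacent xy , edge⇒adjacent yz , edge⇒adjacent xz

    heavy-pair : ∀ {c p q} → Adjacent p q → 3 ≤ w c p + w c q → Adjacent c p × Adjacent c q × Tile (c ∷ p ∷ q ∷ [])
    heavy-pair {c} {p} {q} pq 3≤ with 3≤+⇒2≤* (w≤2 c p) (w≤2 c q) 3≤
    ... | 2≤ with 1≤*⇒1≤ (w c p) (w c q) (≤-trans (s≤s z≤n) 2≤)
    ...   | cp , cq = cp , cq , product-tileˡ pq 2≤

    omit₁ : ∀ {c t₁ t₂ t₃} → IsT3 G t₁ t₂ t₃ →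
      Adjacent c t₂ × Adjacent c t₃ × Tile (c ∷ t₂ ∷ t₃ ∷ []) → Replaceable c t₁ t₂ t₃
    omit₁ {t₁ = t₁} {t₂} {t₃} T₃ t = t₂ , t₃ , t₁ , select-↭ (1 ∷ 1 ∷ []) _ , rotate (T₃⇒triangle T₃) , t
      where
      rotate : Triangle t₁ t₂ t₃ → Triangle t₂ t₃ t₁
      rotate (a₁₂ , a₂₃ , a₁₃) = a₂₃ , adjacent-sym a₁₃ , adjacent-sym a₁₂

    omit₂ : ∀ {c t₁ t₂ t₃} → IsT3 G t₁ t₂ t₃ →
      Adjacent c t₁ × Adjacent c t₃ × Tile (c ∷ t₁ ∷ t₃ ∷ []) → Replaceable c t₁ t₂ t₃
    omit₂ {t₁ = t₁} {t₂} {t₃} T₃ t = t₁ , t₃ , t₂ , select-↭ (0 ∷ 1 ∷ []) _ , flip₂₃ (T₃⇒triangle T₃) , t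
      where
      flip₂₃ : Triangle t₁ t₂ t₃ → Triangle t₁ t₃ t₂
      flip₂₃ (a₁₂ , a₂₃ , a₁₃) = a₁₃ , adjacent-sym a₂₃ , a₁₂

    omit₃ : ∀ {c t₁ t₂ t₃} → IsT3 G t₁ t₂ t₃ →
      Adjacent c t₁ × Adjacent c t₂ × Tile (c ∷ t₁ ∷ t₂ ∷ []) → Replaceable c t₁ t₂ t₃
    omit₃ T₃ t = _ , _ , _ , ↭-refl , T₃⇒triangle T₃ , t

    -- If c is adjacent to all of t₁ → t₂ → t₃, then not both {c, t₁, t₂} and {c, t₂, t₃} are cyclic.
    replaceable : ∀ {c t₁ t₂ t₃} → IsT3 G t₁ t₂ t₃ → 3 ≤ ∑ (w c) (t₁ ∷ t₂ ∷ t₃ ∷ []) → Replaceable c t₁ t₂ t₃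
    replaceable {c} {t₁} {t₂} {t₃} T₃@(e₁₂ , e₂₃ , e₁₃) c-large
      with zero-or-adjacent c t₁ | zero-or-adjacent c t₂ | zero-or-adjacent c t₃
    -- A vertex not adjacent to c leaves the whole weight of at least 3 on the other two.
    ... | inj₁ c₁ | _ | _ = omit₁ T₃ (heavy-pair (edge⇒adjacent e₂₃) (subst (3 ≤_) eq c-large))
      where
      eq : w c t₁ + (w c t₂ + (w c t₃ + 0)) ≡ w c t₂ + w c t₃
      eq rewrite c₁ = cong (w c t₂ +_) (+-identityʳ (w c t₃))
    ... | inj₂ _ | inj₁ c₂ | _ = omit₂ T₃ (heavy-pair (edge⇒adjacent e₁₃) (subst (3 ≤_) eq c-large))
      where
      eq : w c t₁ + (w c t₂ + (w c t₃ + 0)) ≡ w c t₁ + w c t₃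
      eq rewrite c₂ = cong (w c t₁ +_) (+-identityʳ (w c t₃))
    ... | inj₂ _ | inj₂ _ | inj₁ c₃ = omit₃ T₃ (heavy-pair (edge⇒adjacent e₁₂) (subst (3 ≤_) eq c-large))
      where
      eq : w c t₁ + (w c t₂ + (w c t₃ + 0)) ≡ w c t₁ + w c t₂
      eq rewrite c₃ = cong (w c t₁ +_) (+-identityʳ (w c t₂))
    ... | inj₂ c₁ | inj₂ c₂ | inj₂ c₃ with adjacent⇒edge c₁ | adjacent⇒edge c₂
    -- The source of the new tile is t₁, c and t₂ in turn.
    ...   | inj₂ t₁→c | _         = omit₃ T₃ (c₁ , c₂ , Tile-resp-↭ (swap t₁ c ↭-refl) (source t₁→c e₁₂ c₂))
    ...   | inj₁ c→t₁ | inj₁ c→t₂ = omit₃ T₃ (c₁ , c₂ , source c→t₁ c→t₂ (edge⇒adjacent e₁₂))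
    ...   | inj₁ c→t₁ | inj₂ t₂→c = omit₁ T₃ (c₂ , c₃ , Tile-resp-↭ (swap t₂ c ↭-refl) (source t₂→c e₂₃ c₃))

    -- Uncovered paths.

    path-start : ∀ {a b c t₁ t₂ t₃} → Adjacent a b → Adjacent b c → w a c ≡ 0 → IsT3 G t₁ t₂ t₃ →
      5 ≤ ∑ (w a) (t₁ ∷ t₂ ∷ t₃ ∷ []) → 3 ≤ ∑ (w c) (t₁ ∷ t₂ ∷ t₃ ∷ []) →
      Cover (t₁ ∷ t₂ ∷ t₃ ∷ a ∷ b ∷ c ∷ []) → Cover []
    path-start {a} ab bc ac T₃ a-large c-large C with replaceable T₃ c-large
    ... | p , q , t , perm , pqt , cp , cq , cpq = gadget-start ab bc ac pqt (_ , _ , _ , T₃ , perm) cp cq cpq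
            (subst (5 ≤_) (∑-↭ (w a) perm) a-large) (reorder (++⁺ʳ _ perm) C)

    path-cover : ∀ {a b c} → Adjacent a b → Adjacent b c → Cover (a ∷ b ∷ c ∷ []) → Cover []
    path-cover {a} {b} {c} ab bc C with zero-or-adjacent a c
    ... | inj₂ ac = triangle-cover ab bc ac C
    ... | inj₁ ac = finish (heavyTile F 8 C large)
      where
      F : V → ℕ
      F v = w a v + w c v

      ∑w≤6 : ∀ x {u₁ u₂ u₃} → ∑ (w x) (u₁ ∷ u₂ ∷ u₃ ∷ []) ≤ 6
      ∑w≤6 x = +-mono-≤ (w≤2 x _) (+-mono-≤ (w≤2 x _) (+-monoˡ-≤ 0 (w≤2 x _)))

      finish : ∃[ u₁ ] ∃[ u₂ ] ∃[ u₃ ] IsT3 G u₁ u₂ u₃ × 8 < ∑ F (u₁ ∷ u₂ ∷ u₃ ∷ []) ×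
        Cover (u₁ ∷ u₂ ∷ u₃ ∷ a ∷ b ∷ c ∷ []) → Cover []
      finish (u₁ , u₂ , u₃ , T₃ , big , D) = go (5 ≤? α)
        where
        α = ∑ (w a) (u₁ ∷ u₂ ∷ u₃ ∷ [])
        γ = ∑ (w c) (u₁ ∷ u₂ ∷ u₃ ∷ [])

        9≤α+γ : 9 ≤ α + γ
        9≤α+γ = ≤-trans big (≤-reflexive (∑-+ (w a) (w c) (u₁ ∷ u₂ ∷ u₃ ∷ [])))

        -- As α + γ is at least 9 and neither exceeds 6, one is at least 5 and the other at least 3.
        -- If α is below 5, the path is read from c to a.
        go : Dec (5 ≤ α) → Cover []
        go (yes 5≤α) = path-start ab bc ac T₃ 5≤α
          (+-cancelˡ-≤ 6 3 γ (≤-trans 9≤α+γ (+-monoˡ-≤ γ (∑w≤6 a)))) D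
        go (no 5≰α) = path-start (adjacent-sym bc) (adjacent-sym ab) (trans (w-sym c a) ac) T₃
          (+-cancelˡ-≤ 4 5 γ (≤-trans 9≤α+γ (+-monoˡ-≤ γ (s≤s⁻¹ (≰⇒> 5≰α)))))
          (+-cancelʳ-≤ 6 3 α (≤-trans 9≤α+γ (+-monoʳ-≤ α (∑w≤6 c))))
          (rearrange (0 ∷ 0 ∷ 0 ∷ 2 ∷ 1 ∷ []) D)

      m = length (tiles C)

      -- Only b contributes, at most 2 for each end of the path.
      inside : ∑ F (a ∷ b ∷ c ∷ []) ≤ 4
      inside = +-mono-≤ (≤-reflexive (cong₂ _+_ (w-refl a) (trans (w-sym c a) ac)))
        (+-mono-≤ (+-mono-≤ (w≤2 a b) (w≤2 c b)) (+-monoˡ-≤ 0 (≤-reflexive (cong₂ _+_ ac (w-refl c)))))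

      n≡ : n ≡ 3 * suc m
      n≡ = trans (sym (cover-size C)) (sym (*-suc 3 m))

      a≢c : a ≢ c
      a≢c with cover-unique C
      ... | (_ ∷ a≢c ∷ _) ∷ _ = a≢c

      -- The degree sum is at least 8 (m + 1) - 2 = 8 m + 6, which exceeds 4 + 8 m.
      large : ∑ F (a ∷ b ∷ c ∷ []) + 8 * m < total F
      large = +-cancelʳ-< 2 _ _ (begin-strict
        ∑ F (a ∷ b ∷ c ∷ []) + 8 * m + 2     ≤⟨ +-monoˡ-≤ 2 (+-monoˡ-≤ (8 * m) inside) ⟩
        4 + 8 * m + 2                        <⟨ +-monoˡ-< 2 (+-monoˡ-< (8 * m) (<ᵇ⇒< 4 6 _)) ⟩
        6 + 8 * m + 2                        ≡⟨ split m ⟩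
        8 * suc m                            ≤⟨ pair-degrees (suc m) n≡ a≢c ac ⟩
        total (w a) + total (w c) + 2        ≡⟨ cong (_+ 2) (∑-+ (w a) (w c) (allFin n)) ⟨
        total F + 2                          ∎)
        where
        open ≤-Reasoning
        split : ∀ m → 6 + 8 * m + 2 ≡ 8 * suc m
        split = solve-∀

-- Adding and removing edges.

_⊆ᴱ_ : ∀ {n} → Digraph n → Digraph n → Set
G ⊆ᴱ H = ∀ {x y} → Edge G x y → Edge H x y

length-filterᵇ-mono : ∀ {A : Set} {p q : A → Bool} → (∀ {x} → p x ≡ true → q x ≡ true) →
  ∀ xs → length (filterᵇ p xs) ≤ length (filterᵇ q xs)
length-filterᵇ-mono p⇒q [] = z≤n
length-filterᵇ-mono {p = p} {q} p⇒q (x ∷ xs) with p x in px | q x in qx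
... | true  | true  = s≤s (length-filterᵇ-mono p⇒q xs)
... | true  | false = contradiction (trans (sym (p⇒q px)) qx) λ ()
... | false | true  = m≤n⇒m≤1+n (length-filterᵇ-mono p⇒q xs)
... | false | false = length-filterᵇ-mono p⇒q xs

-- More edges mean larger degrees and fewer nonedges to test.
Ore-mono : ∀ {n} {G H : Digraph n} → G ⊆ᴱ H → Ore G → Ore H
Ore-mono {n} G⊆H ore x y x≢y x↛y = ≤-trans (ore x y x≢y (x↛y ∘ G⊆H))
  (+-monoˡ-≤ 3 (*-monoʳ-≤ 3 (+-mono-≤ (length-filterᵇ-mono G⊆H (allFin n)) (length-filterᵇ-mono G⊆H (allFin n)))))

module _ {n : ℕ} where

  private V = Fin n

  -- The last conjunct makes a diagonal pair change nothing, so all ordered pairs may be added.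
  addEdge : V × V → Digraph n → Digraph n
  addEdge (x , y) G = record
    { adj     = λ u v → adj G u v ∨ (⌊ u ≟ᶠ x ⌋ ∧ ⌊ v ≟ᶠ y ⌋ ∧ not ⌊ u ≟ᶠ v ⌋)
    ; noLoops = no-loop
    }
    where
    no-loop : ∀ u → adj G u u ∨ (⌊ u ≟ᶠ x ⌋ ∧ ⌊ u ≟ᶠ y ⌋ ∧ not ⌊ u ≟ᶠ u ⌋) ≡ false
    no-loop u rewrite noLoops G u with u ≟ᶠ x | u ≟ᶠ y | u ≟ᶠ u
    ... | no  _ | _     | _       = refl
    ... | yes _ | no  _ | _       = refl
    ... | yes _ | yes _ | yes _   = refl
    ... | yes _ | yes _ | no u≢u  = contradiction refl u≢u

  ⊆-addEdge : ∀ e G → G ⊆ᴱ addEdge e G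
  ⊆-addEdge e G uv rewrite uv = refl

  new-edge : ∀ {x y} G → x ≢ y → Edge (addEdge (x , y) G) x y
  new-edge {x} {y} G x≢y with adj G x y | x ≟ᶠ x | y ≟ᶠ y | x ≟ᶠ y
  ... | true  | _      | _      | _     = refl
  ... | false | yes _  | yes _  | no _  = refl
  ... | false | no x≢x | _      | _     = contradiction refl x≢x
  ... | false | yes _  | no y≢y | _     = contradiction refl y≢y
  ... | false | yes _  | yes _  | yes e = contradiction e x≢y

  addEdge-cases : ∀ {x y u v} G → Edge (addEdge (x , y) G) u v → Edge G u v ⊎ (u ≡ x × v ≡ y)
  addEdge-cases {x} {y} {u} {v} G e with adj G u v | u ≟ᶠ x | v ≟ᶠ y
  ... | true  | _       | _       = inj₁ refl
  ... | false | yes u≡x | yes v≡y = inj₂ (u≡x , v≡y)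
  addEdge-cases G () | false | no _  | _
  addEdge-cases G () | false | yes _ | no _

  edge⇒≢ : ∀ (G : Digraph n) {x y} → Edge G x y → x ≢ y
  edge⇒≢ G {x} e refl = contradiction (trans (sym e) (noLoops G x)) λ ()

  Unique⇒∉ : ∀ {a b c x : V} {xs} → Unique (a ∷ b ∷ c ∷ xs) → x ∈ a ∷ b ∷ c ∷ [] → ¬ x ∈ xs
  Unique⇒∉ (a≢ ∷ _)         (here refl)                 x∈ = lookupᴬ a≢ (there (there x∈)) refl
  Unique⇒∉ (_ ∷ b≢ ∷ _)     (there (here refl))         x∈ = lookupᴬ b≢ (there x∈) refl
  Unique⇒∉ (_ ∷ _ ∷ c≢ ∷ _) (there (there (here refl))) x∈ = lookupᴬ c≢ x∈ refl

  ∈-flat⇒tile : ∀ {x : V} ts → x ∈ flat ts →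
    ∃[ a ] ∃[ b ] ∃[ c ] ∃[ us ] ts ↭ (a , b , c) ∷ us × x ∈ a ∷ b ∷ c ∷ []
  ∈-flat⇒tile (t ∷ ts) (here p)                 = _ , _ , _ , ts , ↭-refl , here p
  ∈-flat⇒tile (t ∷ ts) (there (here p))         = _ , _ , _ , ts , ↭-refl , there (here p)
  ∈-flat⇒tile (t ∷ ts) (there (there (here p))) = _ , _ , _ , ts , ↭-refl , there (there (here p))
  ∈-flat⇒tile (t ∷ ts) (there (there (there p))) with ∈-flat⇒tile ts p
  ... | a , b , c , us , q , x∈ = a , b , c , t ∷ us , ↭-trans (prep t q) (swap t _ ↭-refl) , x∈

  old-tiles : ∀ {x y} G ts → ¬ x ∈ flat ts →
    All (λ (a , b , c) → IsT3 (addEdge (x , y) G) a b c) ts → All (λ (a , b , c) → IsT3 G a b c) ts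
  old-tiles G [] _ [] = []
  old-tiles {x} {y} G ((a , b , c) ∷ ts) x∉ ((ab , bc , ac) ∷ t₃) =
    (old (x∉ ∘ here) ab , old (x∉ ∘ there ∘ here) bc , old (x∉ ∘ here) ac) ∷
    old-tiles G ts (x∉ ∘ there ∘ there ∘ there) t₃
    where
    old : ∀ {u v} → ¬ x ≡ u → Edge (addEdge (x , y) G) u v → Edge G u v
    old x≢u uv with addEdge-cases G uv
    ... | inj₁ e         = e
    ... | inj₂ (u≡x , _) = contradiction (sym u≡x) x≢u

  -- The new edge starts at x, so every tile other than the one containing x survives its removal.
  removeEdge-cover : ∀ x y (G : Digraph n) → Ore G → Cover (addEdge (x , y) G) [] → Cover G []
  removeEdge-cover x y G ore (cover ts t₃ p) with ∈-flat⇒tile ts (∈-resp-↭ (↭-sym p) (∈-allFin x))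
  ... | a , b , c , us , q , x∈abc = finish (All-resp-↭ q t₃)
    where
    p′ : a ∷ b ∷ c ∷ flat us ↭ allFin n
    p′ = ↭-trans (↭-sym (flat-↭ q)) p

    x∉us : ¬ x ∈ flat us
    x∉us = Unique⇒∉ (Unique-resp-↭ (≡-setoid V) (↭⇒↭ₛ (↭-sym p′)) (allFin⁺ n)) x∈abc

    finish : All (λ (a , b , c) → IsT3 (addEdge (x , y) G) a b c) ((a , b , c) ∷ us) → Cover G []
    finish ((ab , bc , ac) ∷ us-T₃) = go (addEdge-cases G ab) (addEdge-cases G bc) (addEdge-cases G ac)
      where
      G⁺ = addEdge (x , y) G

      C : Cover G (a ∷ b ∷ c ∷ [])
      C = cover us (old-tiles G us x∉us us-T₃) p′

      adj→ : ∀ {u v} → Edge G u v → Adjacent G u v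
      adj→ = edge⇒adjacent G

      adj← : ∀ {u v} → Edge G v u → Adjacent G u v
      adj← e = adjacent-sym G (edge⇒adjacent G e)

      go : Edge G a b ⊎ (a ≡ x × b ≡ y) → Edge G b c ⊎ (b ≡ x × c ≡ y) → Edge G a c ⊎ (a ≡ x × c ≡ y) → Cover G []
      go (inj₁ ab′) (inj₁ bc′) (inj₁ ac′) = addTile G (a , b , c , (ab′ , bc′ , ac′) , ↭-refl) C
      -- If one edge of the tile is new, the other two form a path through the opposite vertex.
      go (inj₁ ab′) (inj₁ bc′) (inj₂ _)   = path-cover G ore (adj→ ab′) (adj→ bc′) C
      go (inj₁ ab′) (inj₂ _)   (inj₁ ac′) = path-cover G ore (adj← ab′) (adj→ ac′) (rearrange G (1 ∷ []) C)
      go (inj₂ _)   (inj₁ bc′) (inj₁ ac′) = path-cover G ore (adj→ ac′) (adj← bc′) (rearrange G (0 ∷ 1 ∷ []) C)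
      -- If two edges of the tile were both xy, two of its vertices would coincide.
      go (inj₂ (refl , refl)) (inj₂ (b≡a , _)) _ = contradiction (sym b≡a) (edge⇒≢ G⁺ ab)
      go (inj₂ (_ , b≡y)) _ (inj₂ (_ , c≡y)) = contradiction (trans b≡y (sym c≡y)) (edge⇒≢ G⁺ bc)
      go _ (inj₂ (b≡x , _)) (inj₂ (a≡x , _)) = contradiction (trans a≡x (sym b≡x)) (edge⇒≢ G⁺ ab)

  addEdges : List (V × V) → Digraph n → Digraph n
  addEdges es G = foldr addEdge G es

  ⊆-addEdges : ∀ es G → G ⊆ᴱ addEdges es G
  ⊆-addEdges []       G uv = uv
  ⊆-addEdges (e ∷ es) G uv = ⊆-addEdge e (addEdges es G) (⊆-addEdges es G uv)

  new-edges : ∀ {x y} es G → x ≢ y → (x , y) ∈ es → Edge (addEdges es G) x y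
  new-edges (_ ∷ es) G x≢y (here refl) = new-edge (addEdges es G) x≢y
  new-edges (e ∷ es) G x≢y (there xy∈) = ⊆-addEdge e (addEdges es G) (new-edges es G x≢y xy∈)

  -- Every intermediate digraph contains G and so inherits the degree condition.
  removeEdges-cover : ∀ es (G : Digraph n) → Ore G → Cover (addEdges es G) [] → Cover G []
  removeEdges-cover []             G ore C = C
  removeEdges-cover ((x , y) ∷ es) G ore C = removeEdges-cover es G ore
    (removeEdge-cover x y (addEdges es G) (Ore-mono {G = G} {addEdges es G} (⊆-addEdges es G) ore) C)

  -- The complete digraph.

  unflat : ∀ {A : Set} k (xs : List A) → length xs ≡ k * 3 → ∃[ ts ] flat ts ≡ xs
  unflat zero    []               _  = [] , refl
  unflat (suc k) (x ∷ y ∷ z ∷ xs) eq with unflat k xs (suc-injective (suc-injective (suc-injective eq)))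
  ... | ts , refl = (x , y , z) ∷ ts , refl

  complete-T₃ : (G : Digraph n) → (∀ {x y} → x ≢ y → Edge G x y) → ∀ ts → Unique (flat ts) →
    All (λ (a , b , c) → IsT3 G a b c) ts
  complete-T₃ G K [] _ = []
  complete-T₃ G K (_ ∷ ts) ((a≢b ∷ a≢c ∷ _) ∷ (b≢c ∷ _) ∷ _ ∷ u) = (K a≢b , K b≢c , K a≢c) ∷ complete-T₃ G K ts u

  -- Cutting the vertex list into consecutive triples works, as any three distinct vertices form a
  -- tile.
  complete-cover : 3 ∣ n → (G : Digraph n) → (∀ {x y} → x ≢ y → Edge G x y) → Cover G []
  complete-cover (divides k n≡k*3) G K with unflat k (allFin n) (trans (length-tabulate {n = n} (λ i → i)) n≡k*3)
  ... | ts , eq = cover ts (complete-T₃ G K ts (subst Unique (sym eq) (allFin⁺ n))) (↭-reflexive eq)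

  -- From covers to factors.

  entry : V × V × V → Fin 3 → V
  entry (a , b , c) zero             = a
  entry (a , b , c) (suc zero)       = b
  entry (a , b , c) (suc (suc zero)) = c

  entryAt : (ts : List (V × V × V)) → Σ (Fin (length ts)) (λ _ → Fin 3) → V
  entryAt ts (i , j) = entry (lookup ts i) j

  entry-∈ : ∀ {a b c xs} j → entry (a , b , c) j ∈ a ∷ b ∷ c ∷ xs
  entry-∈ zero             = here refl
  entry-∈ (suc zero)       = there (here refl)
  entry-∈ (suc (suc zero)) = there (there (here refl))

  entryAt-∈ : ∀ ts ij → entryAt ts ij ∈ flat ts
  entryAt-∈ (_ ∷ ts) (zero  , j) = entry-∈ j
  entryAt-∈ (_ ∷ ts) (suc i , j) = there (there (there (entryAt-∈ ts (i , j))))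

  entryAt-surjective : ∀ ts {v} → v ∈ flat ts → ∃[ ij ] entryAt ts ij ≡ v
  entryAt-surjective (_ ∷ ts) (here refl)                 = (zero , zero) , refl
  entryAt-surjective (_ ∷ ts) (there (here refl))         = (zero , suc zero) , refl
  entryAt-surjective (_ ∷ ts) (there (there (here refl))) = (zero , suc (suc zero)) , refl
  entryAt-surjective (_ ∷ ts) (there (there (there v∈))) with entryAt-surjective ts v∈
  ... | (i , j) , eq = (suc i , j) , eq

  entry-injective : ∀ {a b c xs} → Unique (a ∷ b ∷ c ∷ xs) → ∀ j j′ →
    entry (a , b , c) j ≡ entry (a , b , c) j′ → j ≡ j′
  entry-injective _ zero             zero             _ = refl
  entry-injective _ (suc zero)       (suc zero)       _ = refl
  entry-injective _ (suc (suc zero)) (suc (suc zero)) _ = refl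
  entry-injective ((a≢b ∷ _) ∷ _)     zero             (suc zero)       e = contradiction e a≢b
  entry-injective ((a≢b ∷ _) ∷ _)     (suc zero)       zero             e = contradiction (sym e) a≢b
  entry-injective ((_ ∷ a≢c ∷ _) ∷ _) zero             (suc (suc zero)) e = contradiction e a≢c
  entry-injective ((_ ∷ a≢c ∷ _) ∷ _) (suc (suc zero)) zero             e = contradiction (sym e) a≢c
  entry-injective (_ ∷ (b≢c ∷ _) ∷ _) (suc zero)       (suc (suc zero)) e = contradiction e b≢c
  entry-injective (_ ∷ (b≢c ∷ _) ∷ _) (suc (suc zero)) (suc zero)       e = contradiction (sym e) b≢c

  entry-∉ : ∀ {a b c v xs} → Unique (a ∷ b ∷ c ∷ xs) → ∀ j → v ∈ xs → entry (a , b , c) j ≢ v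
  entry-∉ u j v∈ refl = Unique⇒∉ u (entry-∈ j) v∈

  -- Entries of the first tile are distinct from each other and cannot recur in the rest of the
  -- list.
  entryAt-injective : ∀ ts → Unique (flat ts) → ∀ {ij kl} → entryAt ts ij ≡ entryAt ts kl → ij ≡ kl
  entryAt-injective (_ ∷ ts) u {zero  , j} {zero  , l} e = cong (zero ,_) (entry-injective u j l e)
  entryAt-injective (_ ∷ ts) u {zero  , j} {suc k , l} e = contradiction e (entry-∉ u j (entryAt-∈ ts (k , l)))
  entryAt-injective (_ ∷ ts) u {suc i , j} {zero  , l} e = contradiction (sym e) (entry-∉ u l (entryAt-∈ ts (i , j)))
  entryAt-injective (_ ∷ ts) (_ ∷ _ ∷ _ ∷ u) {suc i , j} {suc k , l} e with entryAt-injective ts u {i , j} {k , l} e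
  ... | refl = refl

  cover⇒factor : (G : Digraph n) → Cover G [] → HasT3Factor G
  cover⇒factor G C@(cover ts t₃ p) = length ts , (λ i j → entryAt ts (i , j)) ,
    (λ i → lookupᴬ t₃ (∈-lookup i)) , entryAt-injective ts (cover-unique G C) ,
    λ v → surj v (entryAt-surjective ts (∈-resp-↭ (↭-sym p) (∈-allFin v)))
    where
    surj : ∀ v → ∃[ ij ] entryAt ts ij ≡ v →
      ∃[ ij ] (∀ {kl} → kl ≡ ij → entryAt ts kl ≡ v)
    surj v (ij , eq) = ij , λ { refl → eq }

theorem1p9 : (n : ℕ) → 3 ∣ n → (G : Digraph n) →
    (∀ (x y : Fin n) → ¬ (x ≡ y) → ¬ Edge G x y →
    3 * (outdeg G x + indeg G y) + 3 ≥ 4 * n) →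
    HasT3Factor G
-- Adding all ordered pairs makes G complete; the cover found there is carried back to G.
theorem1p9 n 3∣n G ore = cover⇒factor G (removeEdges-cover pairs G ore
  (complete-cover 3∣n (addEdges pairs G)
    λ {x} {y} x≢y → new-edges pairs G x≢y (∈-cartesianProduct⁺ (∈-allFin x) (∈-allFin y))))
  where
  pairs = cartesianProduct (allFin n) (allFin n)
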